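{- Let $G$ be a finite simple graph and $n$ a positive integer. Then the pegging number of the Cartesian product $G \times K_n$ satisfies $P(G \times K_n) \le \pi_2(G)$. Furthermore, $P(G \times K_2) \le \max\{\pi(G), |G|+1\}$.
   Context: All graphs are finite and simple; $|G|$ denotes the number of vertices of $G$ and $K_n$ the complete graph on $n$ vertices. The Cartesian product $G \times H$ has vertex set $V(G)\times V(H)$, with $(g,h)$ adjacent to $(g',h')$ iff either $g=g'$ and $hh' \in E(H)$, or $h=h'$ and $gg'\in E(G)$. Pegging: a distribution of pegs on a graph $\Gamma$ is a subset $D \subseteq V(\Gamma)$. If $u,v \in D$ are distinct adjacent vertices and $w \notin D$ is a vertex adjacent to $v$, the pegging move (jumping $u$ over $v$ into $w$) replaces $D$ by $(D\setminus\{u,v\})\cup\{w\}$. A vertex $t$ is reachable from $D$ if some finite (possibly empty) sequence of pegging moves starting from $D$ ends in a distribution containing $t$; $\mathrm{Reach}(D)$ is the set of reachable vertices. The pegging number $P(\Gamma)$ is the smallest positive integer $d$ such that every distribution of size $d$ on $\Gamma$ has reach $V(\Gamma)$. Pebbling: a pebble distribution on $G$ assigns a nonnegative integer number of pebbles to each vertex; a pebbling move removes two pebbles from one vertex and places one pebble on an adjacent vertex. The pebbling number $\pi(G)$ (respectively two-pebbling number $\pi_2(G)$) is the smallest positive integer $p$ such that for every pebble distribution with $p$ pebbles in total and every vertex $t$, some sequence of pebbling moves places at least one pebble (respectively at least two pebbles) on $t$. These are taken to be infinite if $G$ is disconnected. -}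

module Defs where

open import Data.Bool using (Bool; true; false; _∧_; _∨_; not)
open import Data.Nat using (ℕ; _≤_; _+_; _*_; _⊔_)
open import Data.Fin using (Fin; _≟_; remQuot)
open import Data.Fin.Subset using (Subset; _∈_; _∉_; ∣_∣; inside; outside)
open import Data.Vec using (Vec; lookup; sum; _[_]≔_; _[_]%=_)
open import Data.Nat using (_∸_; suc)
open import Data.Product using (_×_; ∃; ∃-syntax; _,_)
open import Relation.Nullary using (¬_)
open import Relation.Nullary.Decidable using (⌊_⌋)
open import Relation.Binary.PropositionalEquality using (_≡_)
open import Relation.Binary.Construct.Closure.ReflexiveTransitive using (Star)

Adj : ℕ → Set
Adj m = Fin m → Fin m → Bool

IsSimple : ∀ {m} → Adj m → Set
IsSimple {m} G = (∀ (u v : Fin m) → G u v ≡ G v u) × (∀ (v : Fin m) → G v v ≡ false)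

K : (n : ℕ) → Adj n
K n i j = not ⌊ i ≟ j ⌋

_□_ : ∀ {m n} → Adj m → Adj n → Adj (m * n)
_□_ {m} {n} G H x y with remQuot {m} n x | remQuot {m} n y
... | (g , h) | (g' , h') = (⌊ g ≟ g' ⌋ ∧ H h h') ∨ (⌊ h ≟ h' ⌋ ∧ G g g')

PegMove : ∀ {N} → Adj N → Subset N → Subset N → Set
PegMove {N} Γ D D' =
  ∃[ u ] ∃[ v ] ∃[ w ]
    (u ∈ D × v ∈ D × ¬ (u ≡ v) × Γ u v ≡ true × w ∉ D × Γ v w ≡ true ×
     D' ≡ ((D [ u ]≔ outside) [ v ]≔ outside) [ w ]≔ inside)

PegReachable : ∀ {N} → Adj N → Subset N → Fin N → Set
PegReachable Γ D t = ∃[ D' ] (Star (PegMove Γ) D D' × t ∈ D')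

PegGood : ∀ {N} → Adj N → ℕ → Set
PegGood {N} Γ d = ∀ (D : Subset N) → ∣ D ∣ ≡ d → ∀ (t : Fin N) → PegReachable Γ D t

IsPeggingNumber : ∀ {N} → Adj N → ℕ → Set
IsPeggingNumber Γ d = 1 ≤ d × PegGood Γ d × (∀ e → 1 ≤ e → PegGood Γ e → d ≤ e)

PebMove : ∀ {m} → Adj m → Vec ℕ m → Vec ℕ m → Set
PebMove G c c' =
  ∃[ v ] ∃[ w ] (G v w ≡ true × 2 ≤ lookup c v ×
                 c' ≡ (c [ v ]%= (λ x → x ∸ 2)) [ w ]%= suc)

PebSolvable : ∀ {m} → Adj m → ℕ → Vec ℕ m → Fin m → Set
PebSolvable G k c t = ∃[ c' ] (Star (PebMove G) c c' × k ≤ lookup c' t)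

PebGood : ∀ {m} → Adj m → ℕ → ℕ → Set
PebGood {m} G k p = ∀ (c : Vec ℕ m) → sum c ≡ p → ∀ (t : Fin m) → PebSolvable G k c t

-- p is the k-pebbling number (least positive integer with PebGood);
-- if no such p exists the number is infinite.
IsKPebblingNumber : ∀ {m} → ℕ → Adj m → ℕ → Set
IsKPebblingNumber k G p = 1 ≤ p × PebGood G k p × (∀ q → 1 ≤ q → PebGood G k q → p ≤ q)

IsPebblingNumber : ∀ {m} → Adj m → ℕ → Set
IsPebblingNumber = IsKPebblingNumber 1

IsTwoPebblingNumber : ∀ {m} → Adj m → ℕ → Set
IsTwoPebblingNumber = IsKPebblingNumber 2

{-# OPTIONS --safe #-}
module Submission where

-- Write cnt D v for the number of pegs of D in the fibre {v} × K_n.  A pebbling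
-- move v → w is imitated by a jump inside the fibre over v into the fibre over w,
-- unless every peg over v lies opposite a peg over w.  In that case cnt D w is
-- already at least 2, so a later move out of w can be done first, and if this
-- goes round in a cycle, or no such move exists, moves can be discarded.  Two
-- pegs in the fibre of the target reach it by a jump inside that fibre.
--
-- For K_2, if the target (v , h) is empty and so is its fibre, a pebbling
-- sequence delivers a peg to v and its last jump can choose the layer h.  If the
-- other site of the fibre is occupied, a peg delivered to (y , opp h) for a
-- neighbour y of v can jump over it into (v , h); so one may move on to the target
-- (y , opp h).  The set of fibres passed through in this way consists of fibres
-- with exactly one peg, so it can always be extended: with more than m pegs not
-- every fibre has exactly one, and G is connected because p is finite.

open import Defs
open import Data.Bool using (Bool; true; false; if_then_else_; _∧_; _∨_)
import Data.Bool.Properties as Bool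
open import Data.Empty using () renaming (⊥ to Empty)
open import Data.Fin using (Fin; zero; suc; _≟_; remQuot; combine)
open import Data.Fin.Properties using (remQuot-combine; combine-remQuot; combine-injective; any?)
open import Data.Fin.Subset using (Subset; _∈_; _∉_; _⊆_; ∣_∣; ⁅_⁆; ⊤; ⊥)
open import Data.Fin.Subset.Properties
  using (∣p∣≤n; ∣p∣≡n⇒p≡⊤; ∣⁅x⁆∣≡1; ∣⊥∣≡0; p⊆q⇒∣p∣≤∣q∣; nonempty?; Empty-unique; _∈?_; x∈⁅x⁆; ∈⊤; ∉⊥)
open import Data.List using (List; []; _∷_; _++_; length)
open import Data.List.Properties using (++-assoc; length-++)
open import Data.List.Relation.Unary.All using (All; []; _∷_; universal)
open import Data.List.Relation.Unary.All.Properties using (++⁺)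
open import Data.Nat using (ℕ; zero; suc; _≤_; _<_; _⊔_; _⊓_; _+_; _*_; _∸_; z≤n; s≤s) renaming (_≟_ to _≟ℕ_)
open import Data.Nat.Properties hiding (_≟_)
open import Data.Nat.Solver using (module +-*-Solver)
open import Data.Product using (_×_; ∃-syntax; _,_; proj₁; proj₂)
open import Data.Sum using (_⊎_; inj₁; inj₂)
open import Data.Unit using (tt) renaming (⊤ to Unit)
open import Data.Vec using (Vec; []; _∷_; lookup; tabulate; sum; replicate; _[_]≔_; _[_]%=_)
import Data.Vec as Vec
open import Data.Vec.Properties
  using ([]=⇒lookup; lookup⇒[]=; lookup∘update; lookup∘update′; lookup∘updateAt; lookup∘updateAt′;
         lookup∘tabulate; tabulate∘lookup; tabulate-cong; lookup-replicate; lookup-++ˡ; lookup-++ʳ)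
open import Function using (_∘_)
open import Relation.Binary.Construct.Closure.ReflexiveTransitive using (ε; _◅_)
open import Relation.Binary.PropositionalEquality
  using (_≡_; _≢_; refl; sym; trans; cong; cong₂; subst; ≢-sym; module ≡-Reasoning)
open import Relation.Nullary using (¬_; Dec; yes; no; contradiction)
open import Relation.Nullary.Decidable using (⌊_⌋; does; _×-dec_; ¬?; decidable-stable)

private
  variable
    m n : ℕ

-- Pebbling moves on pebble counts.

Counts : ℕ → Set
Counts m = Fin m → ℕ

δ : Fin m → Fin m → ℕ
δ v u = if does (v ≟ u) then 1 else 0

δ-refl : (v : Fin m) → δ v v ≡ 1
δ-refl v with v ≟ v
... | yes _ = refl
... | no v≢v = contradiction refl v≢v

δ-≢ : {v u : Fin m} → v ≢ u → δ v u ≡ 0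
δ-≢ {v = v} {u} v≢u with v ≟ u
... | yes v≡u = contradiction v≡u v≢u
... | no _ = refl

fire : Fin m → Fin m → Counts m → Counts m
fire v w c u = (c u ∸ 2 * δ v u) + δ w u

-- The form of a move without truncated subtraction, so that counts after several moves can be
-- compared by adding and cancelling.
fire-balance : ∀ (v w : Fin m) c u → 2 ≤ c v → fire v w c u + 2 * δ v u ≡ c u + δ w u
fire-balance v w c u 2≤cv = trans (lemma (c u ∸ 2 * δ v u) (δ w u) (2 * δ v u))
                                  (cong (_+ δ w u) (m∸n+n≡m enough))
  where
  open +-*-Solver
  lemma : ∀ x y z → x + y + z ≡ x + z + y
  lemma = solve 3 (λ x y z → x :+ y :+ z := x :+ z :+ y) refl
  enough : 2 * δ v u ≤ c u
  enough with v ≟ u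
  ... | yes refl = 2≤cv
  ... | no _ = z≤n

fire-≥ : ∀ (v w : Fin m) c {u} → v ≢ u → c u ≤ fire v w c u
fire-≥ v w c {u} v≢u rewrite δ-≢ v≢u = m≤m+n (c u) (δ w u)

fire-mono : ∀ (v w : Fin m) {c c' : Counts m} {u} → c u ≤ c' u → fire v w c u ≤ fire v w c' u
fire-mono v w {u = u} le = +-monoˡ-≤ (δ w u) (∸-monoˡ-≤ (2 * δ v u) le)

-- With the spent pebbles added back, both orders give `c u + δ b u + δ x u`; since the sources
-- differ, neither move uses up the pebbles of the other.
fire-comm : ∀ (a b v x : Fin m) c u → 2 ≤ c a → 2 ≤ c v → a ≢ v →
            fire v x (fire a b c) u ≡ fire a b (fire v x c) u
fire-comm a b v x c u 2≤ca 2≤cv a≢v =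
  +-cancelʳ-≡ (2 * δ a u + 2 * δ v u) _ _ (begin
    fire v x (fire a b c) u + (α + ν)  ≡⟨ swap (fire v x (fire a b c) u) α ν ⟩
    fire v x (fire a b c) u + ν + α    ≡⟨ cong (_+ α) (fire-balance v x (fire a b c) u (≤-trans 2≤cv (fire-≥ a b c a≢v))) ⟩
    fire a b c u + δ x u + α           ≡⟨ swap′ (fire a b c u) (δ x u) α ⟩
    fire a b c u + α + δ x u           ≡⟨ cong (_+ δ x u) (fire-balance a b c u 2≤ca) ⟩
    c u + δ b u + δ x u                ≡⟨ swap′ (c u) (δ b u) (δ x u) ⟩
    c u + δ x u + δ b u                ≡⟨ cong (_+ δ b u) (fire-balance v x c u 2≤cv) ⟨
    fire v x c u + ν + δ b u           ≡⟨ swap′ (fire v x c u) ν (δ b u) ⟩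
    fire v x c u + δ b u + ν           ≡⟨ cong (_+ ν) (fire-balance a b (fire v x c) u (≤-trans 2≤ca (fire-≥ v x c (≢-sym a≢v)))) ⟨
    fire a b (fire v x c) u + α + ν    ≡⟨ +-assoc (fire a b (fire v x c) u) α ν ⟩
    fire a b (fire v x c) u + (α + ν)  ∎)
  where
  open ≡-Reasoning
  open +-*-Solver
  α = 2 * δ a u
  ν = 2 * δ v u
  swap : ∀ p q r → p + (q + r) ≡ p + r + q
  swap = solve 3 (λ p q r → p :+ (q :+ r) := p :+ r :+ q) refl
  swap′ : ∀ p q r → p + q + r ≡ p + r + q
  swap′ = solve 3 (λ p q r → p :+ q :+ r := p :+ r :+ q) refl

-- Legal sequences of pebbling moves and their rearrangement.

Moves : ℕ → Set
Moves m = List (Fin m × Fin m)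

data Legal (G : Adj m) (k : ℕ) (τ : Fin m) (c : Counts m) : Moves m → Set where
  stop : k ≤ c τ → Legal G k τ c []
  move : ∀ {v w L} → G v w ≡ true → 2 ≤ c v → Legal G k τ (fire v w c) L →
         Legal G k τ c ((v , w) ∷ L)

AvoidsSource : Fin m → Moves m → Set
AvoidsSource w = All (λ e → proj₁ e ≢ w)

module _ {G : Adj m} {k : ℕ} {τ : Fin m} where

  -- A legal sequence tests counts only at the sources of its moves and at `τ`.
  Legal-mono-on : {Q : Fin m → Set} {c c' : Counts m} {L : Moves m} →
                  All (Q ∘ proj₁) L → Q τ → (∀ u → Q u → c u ≤ c' u) →
                  Legal G k τ c L → Legal G k τ c' L
  Legal-mono-on [] qτ le (stop k≤) = stop (≤-trans k≤ (le _ qτ))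
  Legal-mono-on {c = c} {c'} (qv ∷ qs) qτ le (move {v} {w} e 2≤ l) =
    move e (≤-trans 2≤ (le v qv))
      (Legal-mono-on qs qτ (λ u q → fire-mono v w {c} {c'} (le u q)) l)

  Legal-mono : {c c' : Counts m} {L : Moves m} → (∀ u → c u ≤ c' u) →
               Legal G k τ c L → Legal G k τ c' L
  Legal-mono {L = L} le =
    Legal-mono-on {Q = λ u → u ≡ u} (universal (λ _ → refl) L) refl (λ u _ → le u)

  -- The pebble brought to `w` is neither spent nor counted later, and at every other vertex the
  -- first move can only lower the count.
  Legal-drop : ∀ {c v w L} → AvoidsSource w L → τ ≢ w →
               Legal G k τ c ((v , w) ∷ L) → Legal G k τ c L
  Legal-drop {c} {v} {w} avoid τ≢w (move e 2≤ l) = Legal-mono-on avoid τ≢w le l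
    where
    le : ∀ u → u ≢ w → fire v w c u ≤ c u
    le u u≢w rewrite δ-≢ (≢-sym u≢w) | +-identityʳ (c u ∸ 2 * δ v u) = m∸n≤m (c u) (2 * δ v u)

  -- No move of `L₁` takes pebbles from `w`, so the two lying there at the start let the move out of
  -- `w` be pulled forward past each move of `L₁` by `fire-comm`.
  Legal-extract : ∀ {c w x} L₁ {L₂} → AvoidsSource w L₁ → 2 ≤ c w →
                  Legal G k τ c (L₁ ++ (w , x) ∷ L₂) → Legal G k τ c ((w , x) ∷ L₁ ++ L₂)
  Legal-extract [] avoid 2≤ l = l
  Legal-extract {c} {w} {x} ((a , b) ∷ L₁) (a≢w ∷ avoid) 2≤ (move e 2≤ca l)
    with Legal-extract L₁ avoid (≤-trans 2≤ (fire-≥ a b c a≢w)) l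
  ... | move e' _ l' =
    move e' 2≤ (move e (≤-trans 2≤ca (fire-≥ w x c (≢-sym a≢w)))
      (Legal-mono (λ u → ≤-reflexive (fire-comm a b w x c u 2≤ca 2≤ a≢w)) l'))

-- A walk listed backwards: the first move ends at the given vertex, and each
-- move ends where the preceding entry of the list starts.
data Trail {m : ℕ} : Moves m → Fin m → Set where
  []  : ∀ {w} → Trail [] w
  _∷_ : ∀ {P w} (v : Fin m) → Trail P v → Trail ((v , w) ∷ P) w

-- Executing a closed trail never increases a count, so it may be cut out.
Legal-cut : ∀ {G : Adj m} {k τ w x} {c₀ c : Counts m} P {P' S y} →
            Trail (P ++ (w , x) ∷ P') y → (∀ u → c u + δ y u ≤ c₀ u + δ w u) →
            Legal G k τ c ((P ++ (w , x) ∷ P') ++ S) → Legal G k τ c₀ (P' ++ S)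
Legal-cut {w = w} {c₀ = c₀} {c} [] {y = y} (_ ∷ _) le (move _ 2≤ l) = Legal-mono le' l
  where
  open ≤-Reasoning
  le' : ∀ u → fire w y c u ≤ c₀ u
  le' u = +-cancelʳ-≤ (δ w u) _ _ (begin
    fire w y c u + δ w u      ≤⟨ +-monoʳ-≤ (fire w y c u) (m≤m+n (δ w u) _) ⟩
    fire w y c u + 2 * δ w u  ≡⟨ fire-balance w y c u 2≤ ⟩
    c u + δ y u               ≤⟨ le u ⟩
    c₀ u + δ w u              ∎)
Legal-cut {w = w} {c₀ = c₀} {c} ((v , _) ∷ P) {y = y} (_ ∷ t) le (move _ 2≤ l) = Legal-cut P t le' l
  where
  open ≤-Reasoning
  -- One of the two pebbles spent at `v` stays in the inequality as a debt, which the next move of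
  -- the trail repays by ending at `v`.
  le' : ∀ u → fire v y c u + δ v u ≤ c₀ u + δ w u
  le' u = begin
    fire v y c u + δ v u      ≤⟨ +-monoʳ-≤ (fire v y c u) (m≤m+n (δ v u) _) ⟩
    fire v y c u + 2 * δ v u  ≡⟨ fire-balance v y c u 2≤ ⟩
    c u + δ y u               ≤⟨ le u ⟩
    c₀ u + δ w u              ∎

-- Simulation of a pebbling sequence when moves may be blocked.

firstFrom : (w : Fin m) (L : Moves m) →
            AvoidsSource w L ⊎
            (∃[ L₁ ] ∃[ x ] ∃[ L₂ ] (L ≡ L₁ ++ (w , x) ∷ L₂ × AvoidsSource w L₁))
firstFrom w [] = inj₁ []
firstFrom w ((v , x) ∷ L) with v ≟ w
... | yes refl = inj₂ ([] , x , L , refl , [])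
... | no v≢w with firstFrom w L
...   | inj₁ avoid = inj₁ (v≢w ∷ avoid)
...   | inj₂ (L₁ , y , L₂ , refl , avoid) = inj₂ ((v , x) ∷ L₁ , y , L₂ , refl , v≢w ∷ avoid)

-- `perform` answers 2 ≤ cnt D w for a blocked move; such a move is postponed in
-- favour of the first move out of w.  The postponed moves form a trail: if w is
-- already a source on it, the cycle is cut out, and if no move leaves w, the
-- blocked move is superfluous.
module Simulation
  {m : ℕ} {S : Set} (G : Adj m) (k : ℕ) (k≤2 : k ≤ 2) (τ : Fin m)
  (cnt : S → Counts m) (Inv Goal : S → Set)
  (finish : ∀ D → Inv D → k ≤ cnt D τ → Goal D)
  (perform : ∀ D v w → Inv D → G v w ≡ true → 2 ≤ cnt D v →
             2 ≤ cnt D w ⊎ Goal D ⊎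
             ∃[ D' ] (Inv D' × (∀ u → fire v w (cnt D) u ≤ cnt D' u) × (Goal D' → Goal D)))
  where

  Solves : ℕ → Set
  Solves N = ∀ D L → length L ≤ N → Inv D → Legal G k τ (cnt D) L → Goal D

  module _ {N : ℕ} (shorter : Solves N) (D : S) (inv : Inv D) where

    -- The state `D` stays fixed while moves pass from `S` to the trail, and `ℓ` bounds how many are
    -- left in `S`. Performing or discarding a move leaves a sequence of length at most `N` for
    -- `shorter`.
    search : ∀ ℓ P v w S → length S ≤ ℓ → length (P ++ S) ≤ N → Trail P v → 2 ≤ cnt D w →
             Legal G k τ (cnt D) ((v , w) ∷ P ++ S) → Goal D

    advance : ∀ ℓ P v w S → length S ≤ ℓ → length (P ++ S) ≤ N → Trail P v →
              Legal G k τ (cnt D) ((v , w) ∷ P ++ S) → Goal D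
    advance ℓ P v w S S≤ PS≤ t l@(move e 2≤ l') with perform D v w inv e 2≤
    ... | inj₁ 2≤w = search ℓ P v w S S≤ PS≤ t 2≤w l
    ... | inj₂ (inj₁ goal) = goal
    ... | inj₂ (inj₂ (D' , inv' , le , back)) = back (shorter D' (P ++ S) PS≤ inv' (Legal-mono le l'))

    search ℓ P v w S S≤ PS≤ t 2≤w l with τ ≟ w
    -- A blocked move ending at `τ` shows that the count there is already two, enough because
    -- `k ≤ 2`.
    ... | yes refl = finish D inv (≤-trans k≤2 2≤w)
    ... | no τ≢w with firstFrom w ((v , w) ∷ P)
    ...   | inj₂ (P₁ , x , P₂ , eq , _) =
            shorter D (P₂ ++ S) (≤-trans short PS≤) inv
              (Legal-cut P₁ (subst (λ p → Trail p w) eq (v ∷ t)) (λ u → ≤-refl)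
                 (subst (λ p → Legal G k τ (cnt D) (p ++ S)) eq l))
            where
            open ≤-Reasoning
            short : length (P₂ ++ S) ≤ length (P ++ S)
            short = ≤-pred (begin
              suc (length (P₂ ++ S))               ≤⟨ s≤s (m≤n+m _ (length P₁)) ⟩
              suc (length P₁ + length (P₂ ++ S))   ≡⟨ +-suc (length P₁) _ ⟨
              length P₁ + length ((w , x) ∷ P₂ ++ S) ≡⟨ length-++ P₁ ⟨
              length (P₁ ++ (w , x) ∷ P₂ ++ S)     ≡⟨ cong length (++-assoc P₁ _ S) ⟨
              length ((P₁ ++ (w , x) ∷ P₂) ++ S)   ≡⟨ cong (λ p → length (p ++ S)) eq ⟨
              suc (length (P ++ S))                ∎)
    ...   | inj₁ (v≢w ∷ avoidP) with firstFrom w S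
    ...     | inj₁ avoidS = shorter D (P ++ S) PS≤ inv (Legal-drop (++⁺ avoidP avoidS) τ≢w l)
    ...     | inj₂ (S₁ , x , S₂ , refl , avoidS) = next ℓ S≤
      where
      len : length (S₁ ++ (w , x) ∷ S₂) ≡ suc (length (S₁ ++ S₂))
      len = trans (length-++ S₁) (trans (+-suc (length S₁) _) (cong suc (sym (length-++ S₁))))
      -- The move out of `w` takes over the head and `(v , w)` joins the trail, so the length behind
      -- the head is unchanged.
      total : length (((v , w) ∷ P) ++ S₁ ++ S₂) ≡ length (P ++ S₁ ++ (w , x) ∷ S₂)
      total = trans (cong suc (length-++ P))
        (trans (sym (+-suc (length P) _)) (trans (cong (length P +_) (sym len)) (sym (length-++ P))))
      l″ : Legal G k τ (cnt D) ((w , x) ∷ ((v , w) ∷ P) ++ S₁ ++ S₂)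
      l″ = subst (λ p → Legal G k τ (cnt D) ((w , x) ∷ p)) (++-assoc ((v , w) ∷ P) S₁ S₂)
             (Legal-extract (((v , w) ∷ P) ++ S₁) (++⁺ (v≢w ∷ avoidP) avoidS) 2≤w
               (subst (Legal G k τ (cnt D)) (sym (++-assoc ((v , w) ∷ P) S₁ _)) l))
      next : ∀ ℓ → length (S₁ ++ (w , x) ∷ S₂) ≤ ℓ → Goal D
      next zero S≤ with () ← subst (_≤ 0) len S≤
      next (suc ℓ) S≤ = advance ℓ ((v , w) ∷ P) w x (S₁ ++ S₂)
        (≤-pred (subst (_≤ suc ℓ) len S≤)) (subst (_≤ N) (sym total) PS≤) (v ∷ t) l″

  solves : ∀ N → Solves N
  solves N D [] _ inv (stop k≤) = finish D inv k≤
  solves (suc N) D ((v , w) ∷ L) (s≤s L≤) inv l =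
    advance (solves N) D inv (length L) [] v w L ≤-refl L≤ [] l

  simulate : ∀ D L → Inv D → Legal G k τ (cnt D) L → Goal D
  simulate D L = solves (length L) D L ≤-refl

-- Cardinalities of subsets.

lookup-ext : {A : Set} {xs ys : Vec A n} → (∀ i → lookup xs i ≡ lookup ys i) → xs ≡ ys
lookup-ext {xs = xs} {ys} eq =
  trans (sym (tabulate∘lookup xs)) (trans (tabulate-cong eq) (tabulate∘lookup ys))

card-insert : (p : Subset n) (i : Fin n) → lookup p i ≡ false → ∣ p [ i ]≔ true ∣ ≡ suc ∣ p ∣
card-insert (false ∷ p) zero _ = refl
card-insert (true ∷ p) (suc i) eq = cong suc (card-insert p i eq)
card-insert (false ∷ p) (suc i) eq = card-insert p i eq

card-delete : (p : Subset n) (i : Fin n) → lookup p i ≡ true → suc ∣ p [ i ]≔ false ∣ ≡ ∣ p ∣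
card-delete (true ∷ p) zero _ = refl
card-delete (true ∷ p) (suc i) eq = cong suc (card-delete p i eq)
card-delete (false ∷ p) (suc i) eq = card-delete p i eq

card-++ : (p : Subset m) (q : Subset n) → ∣ p Vec.++ q ∣ ≡ ∣ p ∣ + ∣ q ∣
card-++ [] q = refl
card-++ (true ∷ p) q = cong suc (card-++ p q)
card-++ (false ∷ p) q = card-++ p q

member : (p : Subset n) → 1 ≤ ∣ p ∣ → ∃[ i ] lookup p i ≡ true
member {n} p 1≤ with nonempty? p
... | yes (i , i∈p) = i , []=⇒lookup i∈p
... | no empty = contradiction (trans (cong ∣_∣ (Empty-unique empty)) (∣⊥∣≡0 n)) (≢-sym (<⇒≢ 1≤))

another-member : (p : Subset n) (i : Fin n) → 2 ≤ ∣ p ∣ → ∃[ j ] (j ≢ i × lookup p j ≡ true)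
another-member p i 2≤ with any? (λ j → ¬? (j ≟ i) ×-dec (lookup p j Bool.≟ true))
... | yes found = found
... | no none = contradiction (≤-trans 2≤ (subst (∣ p ∣ ≤_) (∣⁅x⁆∣≡1 i) (p⊆q⇒∣p∣≤∣q∣ p⊆i))) λ { (s≤s ()) }
  where
  p⊆i : p ⊆ ⁅ i ⁆
  p⊆i {j} j∈p with j ≟ i
  ... | yes refl = x∈⁅x⁆ i
  ... | no j≢i = contradiction (j , j≢i , []=⇒lookup j∈p) none

-- Sites, fibres and jumps in the product.

Site : ℕ → ℕ → Set
Site m n = Fin m × Fin n

at : Site m n → Fin (m * n)
at (g , h) = combine g h

at-injective : {s s' : Site m n} → at s ≡ at s' → s ≡ s'
at-injective {s = g , h} {g' , h'} eq with combine-injective g h g' h' eq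
... | refl , refl = refl

-- `_□_` decodes its arguments by `remQuot`; evaluating it on encoded pairs lets the rest of the
-- proof work with sites.
□-at : (G : Adj m) (v w : Fin m) (a b : Fin n) →
       (G □ K n) (at (v , a)) (at (w , b)) ≡ (⌊ v ≟ w ⌋ ∧ K n a b) ∨ (⌊ a ≟ b ⌋ ∧ G v w)
□-at {m} {n} G v w a b = cong₂ adjacent (remQuot-combine {k = n} v a) (remQuot-combine {k = n} w b)
  where
  adjacent : Site m n → Site m n → Bool
  adjacent s s' = (⌊ proj₁ s ≟ proj₁ s' ⌋ ∧ K n (proj₂ s) (proj₂ s')) ∨
                  (⌊ proj₂ s ≟ proj₂ s' ⌋ ∧ G (proj₁ s) (proj₁ s'))

□-fibre : (G : Adj m) {v : Fin m} {a b : Fin n} → a ≢ b →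
          (G □ K n) (at (v , a)) (at (v , b)) ≡ true
□-fibre G {v} {a} {b} a≢b rewrite □-at G v v a b with v ≟ v | a ≟ b
... | yes _ | no _ = refl
... | _ | yes a≡b = contradiction a≡b a≢b
... | no v≢v | _ = contradiction refl v≢v

□-layer : (G : Adj m) {v w : Fin m} {b : Fin n} → G v w ≡ true →
          (G □ K n) (at (v , b)) (at (w , b)) ≡ true
□-layer {n = n} G {v} {w} {b} e rewrite □-at G v w b b | e with b ≟ b
... | yes _ = Bool.∨-zeroʳ _
... | no b≢b = contradiction refl b≢b

module _ {m n : ℕ} where

  peg : Subset (m * n) → Site m n → Bool
  peg D s = lookup D (at s)

  put : Subset (m * n) → Site m n → Bool → Subset (m * n)
  put D s b = D [ at s ]≔ b

  peg-put : ∀ D s b → peg (put D s b) s ≡ b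
  peg-put D s b = lookup∘update (at s) D b

  peg-put-≢ : ∀ D {s s'} b → s' ≢ s → peg (put D s b) s' ≡ peg D s'
  peg-put-≢ D b s'≢s = lookup∘update′ (s'≢s ∘ at-injective) D b

  fibre : Subset (m * n) → Fin m → Subset n
  fibre D g = tabulate (λ h → peg D (g , h))

  cnt : Subset (m * n) → Counts m
  cnt D g = ∣ fibre D g ∣

  lookup-fibre : ∀ D g h → lookup (fibre D g) h ≡ peg D (g , h)
  lookup-fibre D g h = lookup∘tabulate (λ h → peg D (g , h)) h

  fibre-put : ∀ D g h b → fibre (put D (g , h) b) g ≡ fibre D g [ h ]≔ b
  fibre-put D g h b = lookup-ext λ i → trans (lookup-fibre (put D (g , h) b) g i) (pointwise i)
    where
    pointwise : ∀ i → peg (put D (g , h) b) (g , i) ≡ lookup (fibre D g [ h ]≔ b) i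
    pointwise i with i ≟ h
    ... | yes refl = trans (peg-put D (g , h) b) (sym (lookup∘update h (fibre D g) b))
    ... | no i≢h = trans (peg-put-≢ D b (i≢h ∘ cong proj₂))
                     (trans (sym (lookup-fibre D g i)) (sym (lookup∘update′ i≢h (fibre D g) b)))

  cnt-insert : ∀ D {g h} → peg D (g , h) ≡ false → cnt (put D (g , h) true) g ≡ suc (cnt D g)
  cnt-insert D {g} {h} eq = trans (cong ∣_∣ (fibre-put D g h true))
    (card-insert (fibre D g) h (trans (lookup-fibre D g h) eq))

  cnt-delete : ∀ D {g h} → peg D (g , h) ≡ true → suc (cnt (put D (g , h) false) g) ≡ cnt D g
  cnt-delete D {g} {h} eq = trans (cong (suc ∘ ∣_∣) (fibre-put D g h false))
    (card-delete (fibre D g) h (trans (lookup-fibre D g h) eq))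

  cnt-put-≢ : ∀ D {g g' h b} → g' ≢ g → cnt (put D (g , h) b) g' ≡ cnt D g'
  cnt-put-≢ D {g' = g'} {b = b} g'≢g =
    cong (∣_∣ {n}) (tabulate-cong (λ i → peg-put-≢ D {s' = g' , i} b (g'≢g ∘ cong proj₁)))

  leap : Subset (m * n) → Site m n → Site m n → Site m n → Subset (m * n)
  leap D x y z = put (put (put D x false) y false) z true

  peg-leap : ∀ D x y z → peg (leap D x y z) z ≡ true
  peg-leap D x y z = peg-put (put (put D x false) y false) z true

  peg-leap-≢ : ∀ D {x y z s} → s ≢ x → s ≢ y → s ≢ z → peg (leap D x y z) s ≡ peg D s
  peg-leap-≢ D {x} {y} s≢x s≢y s≢z =
    trans (peg-put-≢ (put (put D x false) y false) true s≢z)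
      (trans (peg-put-≢ (put D x false) false s≢y) (peg-put-≢ D false s≢x))

  Reach : Adj m → Site m n → Subset (m * n) → Set
  Reach G t D = PegReachable (G □ K n) D (at t)

  already : (G : Adj m) {t : Site m n} {D : Subset (m * n)} → peg D t ≡ true → Reach G t D
  already G {t} {D} eq = D , ε , lookup⇒[]= (at t) D eq

  leap-reach : (G : Adj m) {t : Site m n} (D : Subset (m * n)) {x y z : Site m n} →
               peg D x ≡ true → peg D y ≡ true → peg D z ≡ false → x ≢ y →
               (G □ K n) (at x) (at y) ≡ true → (G □ K n) (at y) (at z) ≡ true →
               Reach G t (leap D x y z) → Reach G t D
  leap-reach G D {x} {y} {z} px py pz x≢y exy eyz (D' , steps , t∈D') =
    D' , (at x , at y , at z , lookup⇒[]= (at x) D px , lookup⇒[]= (at y) D py ,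
          (x≢y ∘ at-injective) , exy ,
          (λ z∈D → contradiction (trans (sym pz) ([]=⇒lookup z∈D)) λ ()) , eyz , refl) ◅ steps , t∈D'

  -- The jump that imitates a pebbling move from `v` to `w`: the jumped peg shares a fibre with the
  -- first site and a layer with the last.
  shift : Subset (m * n) → Fin m → Fin m → Fin n → Fin n → Subset (m * n)
  shift D v w a b = leap D (v , a) (v , b) (w , b)

  shift-reach : (G : Adj m) {t : Site m n} (D : Subset (m * n)) {v w : Fin m} {a b : Fin n} →
                G v w ≡ true → a ≢ b → peg D (v , a) ≡ true → peg D (v , b) ≡ true →
                peg D (w , b) ≡ false → Reach G t (shift D v w a b) → Reach G t D
  shift-reach G D e a≢b pa pb pw =
    leap-reach G D pa pb pw (a≢b ∘ cong proj₂) (□-fibre G a≢b) (□-layer G e)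

  shift-counts : ∀ D {v w a b} → v ≢ w → a ≢ b → peg D (v , a) ≡ true → peg D (v , b) ≡ true →
                 peg D (w , b) ≡ false → ∀ u → fire v w (cnt D) u ≤ cnt (shift D v w a b) u
  shift-counts D {v} {w} {a} {b} v≢w a≢b pa pb pw u = case (v ≟ u) (w ≟ u)
    where
    D₁ = put D (v , a) false
    D₂ = put D₁ (v , b) false
    pb₁ : peg D₁ (v , b) ≡ true
    pb₁ = trans (peg-put-≢ D false (≢-sym a≢b ∘ cong proj₂)) pb
    pw₂ : peg D₂ (w , b) ≡ false
    pw₂ = trans (peg-put-≢ D₁ false (≢-sym v≢w ∘ cong proj₁))
            (trans (peg-put-≢ D false (≢-sym v≢w ∘ cong proj₁)) pw)
    case : Dec (v ≡ u) → Dec (w ≡ u) → fire v w (cnt D) u ≤ cnt (shift D v w a b) u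
    case (yes refl) (yes refl) = contradiction refl v≢w
    case (yes refl) (no w≢v) rewrite δ-refl v | δ-≢ w≢v = ≤-reflexive (begin
      (cnt D v ∸ 2) + 0        ≡⟨ +-identityʳ _ ⟩
      cnt D v ∸ 2              ≡⟨ cong (_∸ 2) (sym (cnt-delete D pa)) ⟩
      cnt D₁ v ∸ 1             ≡⟨ cong (_∸ 1) (sym (cnt-delete D₁ pb₁)) ⟩
      cnt D₂ v                 ≡⟨ sym (cnt-put-≢ D₂ v≢w) ⟩
      cnt (shift D v w a b) v  ∎)
      where open ≡-Reasoning
    case (no v≢u) (yes refl) rewrite δ-refl w | δ-≢ v≢u = ≤-reflexive (begin
      cnt D w + 1              ≡⟨ +-comm (cnt D w) 1 ⟩
      suc (cnt D w)            ≡⟨ cong suc (sym (trans (cnt-put-≢ D₁ (≢-sym v≢w)) (cnt-put-≢ D (≢-sym v≢w)))) ⟩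
      suc (cnt D₂ w)           ≡⟨ sym (cnt-insert D₂ pw₂) ⟩
      cnt (shift D v w a b) w  ∎)
      where open ≡-Reasoning
    case (no v≢u) (no w≢u) rewrite δ-≢ v≢u | δ-≢ w≢u = ≤-reflexive (begin
      cnt D u + 0              ≡⟨ +-identityʳ _ ⟩
      cnt D u                  ≡⟨ sym (trans (cnt-put-≢ D₂ (≢-sym w≢u)) (trans (cnt-put-≢ D₁ (≢-sym v≢u)) (cnt-put-≢ D (≢-sym v≢u)))) ⟩
      cnt (shift D v w a b) u  ∎)
      where open ≡-Reasoning

  -- If no peg over `v` faces a gap over `w`, the fibre over `v` is contained in the one over `w`,
  -- which then has two pegs. Otherwise a second peg over `v` can jump over the peg that faces the
  -- gap.
  shiftable : ∀ D v w → 2 ≤ cnt D v →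
              2 ≤ cnt D w ⊎
              ∃[ a ] ∃[ b ] (a ≢ b × peg D (v , a) ≡ true × peg D (v , b) ≡ true × peg D (w , b) ≡ false)
  shiftable D v w 2≤ with any? (λ b → (peg D (v , b) Bool.≟ true) ×-dec (peg D (w , b) Bool.≟ false))
  ... | yes (b , pb , pw) with another-member (fibre D v) b 2≤
  ...   | a , a≢b , pa = inj₂ (a , b , a≢b , trans (sym (lookup-fibre D v a)) pa , pb , pw)
  shiftable D v w 2≤ | no none = inj₁ (≤-trans 2≤ (p⊆q⇒∣p∣≤∣q∣ covered))
    where
    covered : fibre D v ⊆ fibre D w
    covered {b} b∈ = lookup⇒[]= b (fibre D w) (trans (lookup-fibre D w b)
      (Bool.¬-not λ pw → none (b , trans (sym (lookup-fibre D v b)) ([]=⇒lookup b∈) , pw)))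

  -- Distinct vertices of `K n` are adjacent, so if `t` is empty, two pegs in its fibre allow a jump
  -- into it.
  full-fibre-reach : (G : Adj m) {t : Site m n} (D : Subset (m * n)) → 2 ≤ cnt D (proj₁ t) → Reach G t D
  full-fibre-reach G {g , h} D 2≤ with peg D (g , h) in eq
  ... | true = already G eq
  ... | false with member (fibre D g) (≤-trans (s≤s z≤n) 2≤)
  ...   | b , pb with another-member (fibre D g) b 2≤
  ...     | a , a≢b , pa =
    leap-reach G D (trans (sym (lookup-fibre D g a)) pa) pb' eq (a≢b ∘ cong proj₂)
      (□-fibre G a≢b) (□-fibre G b≢h) (already G (peg-leap D (g , a) (g , b) (g , h)))
    where
    pb' = trans (sym (lookup-fibre D g b)) pb
    b≢h : b ≢ h
    b≢h refl = contradiction (trans (sym eq) pb') λ ()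

-- From pebble distributions to fibre counts.

sum-cnt : ∀ m (D : Subset (m * n)) → sum (tabulate (cnt {m} {n} D)) ≡ ∣ D ∣
sum-cnt zero [] = refl
-- `combine` lays out the fibres as consecutive blocks of length `n`, so splitting off `n` entries
-- removes the fibre over `zero`.
sum-cnt {n} (suc m) D with Vec.splitAt n D
... | xs , ys , refl = begin
  cnt {suc m} {n} (xs Vec.++ ys) zero + sum (tabulate (λ g → cnt {suc m} {n} (xs Vec.++ ys) (suc g)))
    ≡⟨ cong₂ _+_ (cong ∣_∣ first) (cong sum (tabulate-cong rest)) ⟩
  ∣ xs ∣ + sum (tabulate (cnt {m} {n} ys))  ≡⟨ cong (∣ xs ∣ +_) (sum-cnt m ys) ⟩
  ∣ xs ∣ + ∣ ys ∣                           ≡⟨ card-++ xs ys ⟨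
  ∣ xs Vec.++ ys ∣                          ∎
  where
  open ≡-Reasoning
  first : fibre {suc m} {n} (xs Vec.++ ys) zero ≡ xs
  first = trans (tabulate-cong (lookup-++ˡ xs ys)) (tabulate∘lookup xs)
  rest : ∀ g → cnt {suc m} {n} (xs Vec.++ ys) (suc g) ≡ cnt {m} {n} ys g
  rest g = cong ∣_∣ (tabulate-cong (λ h → lookup-++ʳ xs ys (combine g h)))

lookup-PebMove : ∀ (c : Vec ℕ m) v w u →
                 lookup ((c [ v ]%= (λ x → x ∸ 2)) [ w ]%= suc) u ≡ fire v w (lookup c) u
lookup-PebMove c v w u = trans second (cong (_+ δ w u) first)
  where
  c₁ = c [ v ]%= (λ x → x ∸ 2)
  first : lookup c₁ u ≡ lookup c u ∸ 2 * δ v u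
  first with v ≟ u
  ... | yes refl = lookup∘updateAt v c
  ... | no v≢u = lookup∘updateAt′ u v (≢-sym v≢u) c
  second : lookup (c₁ [ w ]%= suc) u ≡ lookup c₁ u + δ w u
  second with w ≟ u
  ... | yes refl = trans (lookup∘updateAt w c₁) (+-comm 1 (lookup c₁ w))
  ... | no w≢u = trans (lookup∘updateAt′ u w (≢-sym w≢u) c₁) (sym (+-identityʳ (lookup c₁ u)))

solvable⇒legal : ∀ {G : Adj m} {k c τ} → PebSolvable G k c τ → ∃[ L ] Legal G k τ (lookup c) L
solvable⇒legal (_ , ε , k≤) = [] , stop k≤
solvable⇒legal {c = c} (c″ , (v , w , e , 2≤ , refl) ◅ steps , k≤)
  with solvable⇒legal (c″ , steps , k≤)
... | L , l = (v , w) ∷ L , move e 2≤ (Legal-mono (λ u → ≤-reflexive (lookup-PebMove c v w u)) l)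

sum-replicate-0 : ∀ m → sum (replicate m 0) ≡ 0
sum-replicate-0 zero = refl
sum-replicate-0 (suc m) = sum-replicate-0 m

-- `PebGood` concerns exactly `p` pebbles, while there may be more pegs; the surplus is discarded
-- greedily, each entry keeping as much as is still wanted.
below-with-sum : (c : Vec ℕ m) (p : ℕ) → p ≤ sum c →
                 ∃[ c' ] (sum c' ≡ p × (∀ i → lookup c' i ≤ lookup c i))
below-with-sum [] .0 z≤n = [] , refl , λ ()
below-with-sum (x ∷ c) p p≤ with below-with-sum c (p ∸ x) (m≤n+o⇒m∸n≤o p x p≤)
... | c' , sum≡ , le = x ⊓ p ∷ c' , trans (cong (x ⊓ p +_) sum≡) (m⊓n+n∸m≡n x p) , le'
  where
  le' : ∀ i → lookup (x ⊓ p ∷ c') i ≤ lookup (x ∷ c) i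
  le' zero = m⊓n≤m x p
  le' (suc i) = le i

all-ones-sum : (c : Vec ℕ m) → (∀ i → lookup c i ≡ 1) → sum c ≡ m
all-ones-sum [] _ = refl
all-ones-sum (x ∷ c) ones = cong₂ _+_ (ones zero) (all-ones-sum c (ones ∘ suc))

sum-concentrated : (f : Fin m) (p : ℕ) → sum (replicate m 0 [ f ]≔ p) ≡ p
sum-concentrated {suc m} zero p = trans (cong (p +_) (sum-replicate-0 m)) (+-identityʳ p)
sum-concentrated (suc f) p = sum-concentrated f p

-- No move can start in a set without pebbles, so the set stays empty until some move enters it, and
-- `τ` gets no pebble before that.
entering-edge : ∀ {G : Adj m} {τ c L} (A : Subset m) → τ ∈ A → (∀ u → u ∈ A → c u ≡ 0) →
                Legal G 1 τ c L → ∃[ y ] ∃[ a ] (y ∉ A × a ∈ A × G y a ≡ true)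
entering-edge A τ∈A zeros (stop 1≤) = contradiction (subst (1 ≤_) (zeros _ τ∈A) 1≤) λ ()
entering-edge {c = c} A τ∈A zeros (move {v} {w} e 2≤ l) with v ∈? A | w ∈? A
... | yes v∈A | _ = contradiction (subst (2 ≤_) (zeros v v∈A) 2≤) λ ()
... | no v∉A | yes w∈A = v , w , v∉A , w∈A , e
... | no v∉A | no w∉A = entering-edge A τ∈A zeros' l
  where
  zeros' : ∀ u → u ∈ A → fire v w c u ≡ 0
  zeros' u u∈A rewrite δ-≢ {v = v} {u} (λ { refl → v∉A u∈A }) | δ-≢ {v = w} {u} (λ { refl → w∉A u∈A })
    = trans (+-identityʳ (c u)) (zeros u u∈A)

good⇒legal : ∀ {G : Adj m} {k p} → PebGood G k p → (D : Subset (m * n)) → p ≤ ∣ D ∣ → ∀ τ →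
             ∃[ L ] Legal G k τ (cnt {m} {n} D) L
good⇒legal {m} {n} {p = p} good D p≤ τ
  with below-with-sum (tabulate (cnt {m} {n} D)) p (subst (p ≤_) (sym (sum-cnt m D)) p≤)
... | c , sum≡ , le with solvable⇒legal (good c sum≡ τ)
...   | L , l = L , Legal-mono (λ u → subst (lookup c u ≤_) (lookup∘tabulate (cnt {m} {n} D) u) (le u)) l

-- Simulation by jumps and the bound by the two-pebbling number.

no-loop : {G : Adj m} → IsSimple G → ∀ {v w} → G v w ≡ true → v ≢ w
no-loop (_ , irreflexive) {v} e refl = contradiction (trans (sym e) (irreflexive v)) λ ()

-- `Inv` is left open because the two bounds differ here: the first takes a trivial invariant, the
-- second protects certain fibres, and a jump that would disturb them has to yield `t` instead.
simulate-by-pegging :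
  ∀ {G : Adj m} {k τ L} (t : Site m n) → IsSimple G → k ≤ 2 → (Inv : Subset (m * n) → Set) →
  (∀ D → Inv D → k ≤ cnt {m} {n} D τ → Reach G t D) →
  (∀ D v w a b → Inv D → G v w ≡ true → 2 ≤ cnt {m} {n} D v → a ≢ b →
     peg D (v , a) ≡ true → peg D (v , b) ≡ true → peg D (w , b) ≡ false →
     Reach G t D ⊎ Inv (shift D v w a b)) →
  ∀ D → Inv D → Legal G k τ (cnt {m} {n} D) L → Reach G t D
simulate-by-pegging {m} {n} {G} {k} {τ} {L} t simple k≤2 Inv finish jump D =
  Simulation.simulate G k k≤2 τ (cnt {m} {n}) Inv (Reach G t) finish perform D L
  where
  perform : ∀ D v w → Inv D → G v w ≡ true → 2 ≤ cnt {m} {n} D v →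
            2 ≤ cnt {m} {n} D w ⊎ Reach G t D ⊎
            ∃[ D' ] (Inv D' × (∀ u → fire v w (cnt {m} {n} D) u ≤ cnt {m} {n} D' u) ×
                     (Reach G t D' → Reach G t D))
  perform D v w inv e 2≤ with shiftable {m} {n} D v w 2≤
  ... | inj₁ 2≤w = inj₁ 2≤w
  ... | inj₂ (a , b , a≢b , pa , pb , pw) with jump D v w a b inv e 2≤ a≢b pa pb pw
  ...   | inj₁ reached = inj₂ (inj₁ reached)
  ...   | inj₂ inv' = inj₂ (inj₂ (shift D v w a b , inv' ,
            shift-counts D (no-loop simple e) a≢b pa pb pw , shift-reach G D e a≢b pa pb pw))

two-pebbling⇒pegging : ∀ {G : Adj m} {p} → IsSimple G → PebGood G 2 p → PegGood (G □ K n) p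
two-pebbling⇒pegging {m} {n} {G} simple good D refl x =
  subst (PegReachable (G □ K n) D) (combine-remQuot {m} n x)
    (simulate-by-pegging t simple ≤-refl (λ _ → Unit)
      (λ D _ → full-fibre-reach G D) (λ _ _ _ _ _ _ _ _ _ _ _ _ → inj₂ tt)
      D tt (proj₂ (good⇒legal {n = n} good D ≤-refl (proj₁ t))))
  where
  t : Site m n
  t = remQuot n x

-- Chains of jumps in `G □ K 2`.

opp : Fin 2 → Fin 2
opp zero = suc zero
opp (suc zero) = zero

opp-≢ : ∀ h → h ≢ opp h
opp-≢ zero ()
opp-≢ (suc zero) ()

opp-involutive : ∀ h → opp (opp h) ≡ h
opp-involutive zero = refl
opp-involutive (suc zero) = refl

≡-or-opp : ∀ h i → i ≡ h ⊎ i ≡ opp h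
≡-or-opp zero zero = inj₁ refl
≡-or-opp zero (suc zero) = inj₂ refl
≡-or-opp (suc zero) zero = inj₂ refl
≡-or-opp (suc zero) (suc zero) = inj₁ refl

full-pair : (p : Subset 2) → 2 ≤ ∣ p ∣ → ∀ h → lookup p h ≡ true
full-pair (true ∷ true ∷ []) _ zero = refl
full-pair (true ∷ true ∷ []) _ (suc zero) = refl
full-pair (true ∷ false ∷ []) (s≤s ()) _
full-pair (false ∷ true ∷ []) (s≤s ()) _
full-pair (false ∷ false ∷ []) () _

half-pair : (p : Subset 2) → ∀ h → lookup p h ≡ true → lookup p (opp h) ≡ false → ∣ p ∣ ≡ 1
half-pair (true ∷ false ∷ []) zero _ _ = refl
half-pair (false ∷ true ∷ []) (suc zero) _ _ = refl
half-pair (true ∷ _ ∷ []) (suc zero) _ ()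

module Flipping {m : ℕ} (G : Adj m) (simple : IsSimple G) (t : Site m 2) (D₀ : Subset (m * 2))
  (legal : ∀ y → ∃[ L ] Legal G 1 y (cnt {m} {2} D₀) L)
  (f : Fin m) (f≢1 : cnt {m} {2} D₀ f ≢ 1)
  (entering : ∀ A → proj₁ t ∈ A → f ∉ A → ∃[ y ] ∃[ a ] (y ∉ A × a ∈ A × G y a ≡ true))
  where

  full-fibre : ∀ (D : Subset (m * 2)) {u} → 2 ≤ cnt {m} {2} D u → ∀ h → peg D (u , h) ≡ true
  full-fibre D {u} 2≤ h = trans (sym (lookup-fibre D u h)) (full-pair (fibre D u) 2≤ h)

  AgreeOn : (Fin m → Set) → Subset (m * 2) → Set
  AgreeOn Q D = ∀ u → Q u → ∀ h → peg D (u , h) ≡ peg D₀ (u , h)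

  AgreeOn-leap : ∀ D {Q u v w a b c} → AgreeOn Q D → ¬ Q u → ¬ Q v → ¬ Q w →
                 AgreeOn Q (leap D (u , a) (v , b) (w , c))
  AgreeOn-leap D agree ¬u ¬v ¬w x q h = trans
    (peg-leap-≢ D {s = x , h} (λ { refl → ¬u q }) (λ { refl → ¬v q }) (λ { refl → ¬w q })) (agree x q h)

  Single : Fin m → Set
  Single v = ∃[ h ] (peg D₀ (v , h) ≡ true × peg D₀ (v , opp h) ≡ false)

  -- Shows that a shift never starts from a protected single fibre: the gap is still there, while
  -- two pegs would fill both sites.
  single≢2 : ∀ D {Q u} → AgreeOn Q D → Q u → Single u → 2 ≤ cnt {m} {2} D u → Empty
  single≢2 D {u = u} agree q (h , _ , empty) 2≤ =
    contradiction (trans (sym empty) (trans (sym (agree u q (opp h))) (full-fibre D 2≤ (opp h)))) λ ()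

  -- Fibres outside `A` are unrestricted, since earlier jumps may have changed them.
  Winning : Subset m → Site m 2 → Set
  Winning A s = ∀ D → AgreeOn (_∈ A) D → peg D s ≡ true → Reach G t D

  -- While the fibres over A are untouched, each of them holds a single peg,
  -- and a further peg on one of them, or next to one of them in its layer,
  -- starts a chain of jumps ending in t.
  record Chain (A : Subset m) : Set where
    field
      single   : ∀ {a} → a ∈ A → Single a
      filled   : ∀ {a} → a ∈ A → ∀ D → AgreeOn (λ u → u ∈ A × u ≢ a) D →
                 (∀ h → peg D (a , h) ≡ true) → Reach G t D
      boundary : ∀ {a y h} → a ∈ A → y ∉ A → G y a ≡ true → peg D₀ (a , h) ≡ true → Winning A (y , h)

  open Chain

  -- A pebbling sequence for `v` is simulated with the fibres over `A` and `v` untouched. The first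
  -- jump that would enter one of them either fills a single fibre or can be made to land on
  -- `(v , h)`, and both win.
  fill-empty : ∀ {A v h} → v ∉ A → Chain A → Winning A (v , h) →
               peg D₀ (v , h) ≡ false → peg D₀ (v , opp h) ≡ false → Reach G t D₀
  fill-empty {A} {v} {h} v∉A chain win e₀ e₁ =
    simulate-by-pegging t simple (s≤s z≤n) Inv finish jump D₀ (λ _ _ _ → refl) (proj₂ (legal v))
    where
    Q : Fin m → Set
    Q u = u ∈ A ⊎ u ≡ v
    Inv = AgreeOn Q

    empty : ∀ D → Inv D → ∀ i → peg D (v , i) ≡ false
    empty D inv i with ≡-or-opp h i
    ... | inj₁ refl = trans (inv v (inj₂ refl) i) e₀
    ... | inj₂ refl = trans (inv v (inj₂ refl) i) e₁

    -- The invariant keeps the fibre over `v` empty, so the simulation cannot end by counting a peg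
    -- there.
    finish : ∀ D → Inv D → 1 ≤ cnt {m} {2} D v → Reach G t D
    finish D inv 1≤ with member (fibre D v) 1≤
    ... | i , pi = contradiction (trans (sym (empty D inv i)) (trans (sym (lookup-fibre D v i)) pi)) λ ()

    jump : ∀ D u w a b → Inv D → G u w ≡ true → 2 ≤ cnt {m} {2} D u → a ≢ b →
           peg D (u , a) ≡ true → peg D (u , b) ≡ true → peg D (w , b) ≡ false →
           Reach G t D ⊎ Inv (shift D u w a b)
    jump D u w a b inv e 2≤ a≢b pa pb pw with w ∈? A | w ≟ v
    -- The jump fills the only gap over `w`, while the fibres over the rest of `A` stay as they
    -- were.
    ... | yes w∈A | _ = inj₁ (shift-reach G D e (opp-≢ i) (full i) (full (opp i)) gap
        (filled chain w∈A D'
          (AgreeOn-leap D (λ x q → inv x (inj₁ (proj₁ q))) (u∉ ∘ inj₁ ∘ proj₁) (u∉ ∘ inj₁ ∘ proj₁) (λ q → proj₂ q refl))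
          both))
      where
      full = full-fibre D 2≤
      u∉ : ¬ Q u
      u∉ (inj₁ u∈A) = single≢2 D inv (inj₁ u∈A) (single chain u∈A) 2≤
      u∉ (inj₂ refl) = contradiction (trans (sym (empty D inv h)) (full h)) λ ()
      i = proj₁ (single chain w∈A)
      gap = trans (inv w (inj₁ w∈A) (opp i)) (proj₂ (proj₂ (single chain w∈A)))
      D' = shift D u w i (opp i)
      w≢u : w ≢ u
      w≢u = ≢-sym (no-loop simple e)
      both : ∀ j → peg D' (w , j) ≡ true
      both j with ≡-or-opp i j
      ... | inj₁ refl = trans
        (peg-leap-≢ D (w≢u ∘ cong proj₁) (w≢u ∘ cong proj₁) (opp-≢ i ∘ cong proj₂))
        (trans (inv w (inj₁ w∈A) i) (proj₁ (proj₂ (single chain w∈A))))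
      ... | inj₂ refl = peg-leap D (u , i) (u , opp i) (w , opp i)
    -- The proposed jump may land in either layer; as both sites over `u` are occupied, one into
    -- layer `h` is available.
    ... | no w∉A | yes refl = inj₁ (shift-reach G D e (≢-sym (opp-≢ h)) (full (opp h)) (full h) (empty D inv h)
        (win D' (AgreeOn-leap D (λ x q → inv x (inj₁ q)) u∉A u∉A v∉A) (peg-leap D (u , opp h) (u , h) (w , h))))
      where
      full = full-fibre D 2≤
      D' = shift D u w (opp h) h
      u∉A : u ∉ A
      u∉A u∈A = single≢2 D inv (inj₁ u∈A) (single chain u∈A) 2≤
    ... | no w∉A | no w≢v = inj₂ (AgreeOn-leap D inv u∉ u∉ λ { (inj₁ w∈A) → w∉A w∈A ; (inj₂ w≡v) → w≢v w≡v })
      where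
      u∉ : ¬ Q u
      u∉ (inj₁ u∈A) = single≢2 D inv (inj₁ u∈A) (single chain u∈A) 2≤
      u∉ (inj₂ refl) = contradiction (trans (sym (empty D inv h)) (full-fibre D 2≤ h)) λ ()

  module _ {A : Subset m} {v : Fin m} where

    ∈-old : ∀ {u} → u ∈ A → u ∈ A [ v ]≔ true
    ∈-old {u} u∈A with u ≟ v
    ... | yes refl = lookup⇒[]= u _ (lookup∘update u A true)
    ... | no u≢v = lookup⇒[]= u _ (trans (lookup∘update′ u≢v A true) ([]=⇒lookup u∈A))

    ∈-new : v ∈ A [ v ]≔ true
    ∈-new = lookup⇒[]= v _ (lookup∘update v A true)

    ∈-split : ∀ {u} → u ∈ A [ v ]≔ true → u ≡ v ⊎ u ∈ A
    ∈-split {u} u∈ with u ≟ v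
    ... | yes u≡v = inj₁ u≡v
    ... | no u≢v = inj₂ (lookup⇒[]= u A (trans (sym (lookup∘update′ u≢v A true)) ([]=⇒lookup u∈)))

  -- A peg at `(v , h)` already wins, hence so does filling the fibre over `v`, and so does a peg
  -- next to the occupied site over `v`, by jumping over it into `(v , h)`. `win` asks for agreement
  -- over `A` only, so altering the fibre over `v` does no harm.
  grow : ∀ {A v h} → v ∉ A → Chain A → Winning A (v , h) →
         peg D₀ (v , h) ≡ false → peg D₀ (v , opp h) ≡ true → Chain (A [ v ]≔ true)
  grow {A} {v} {h} v∉A chain win e₀ e₁ = record { single = single' ; filled = filled' ; boundary = boundary' }
    where
    A' = A [ v ]≔ true
    single' : ∀ {a} → a ∈ A' → Single a
    single' a∈ with ∈-split {A = A} a∈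
    ... | inj₁ refl = opp h , e₁ , trans (cong (λ i → peg D₀ (v , i)) (opp-involutive h)) e₀
    ... | inj₂ a∈A = single chain a∈A
    filled' : ∀ {a} → a ∈ A' → ∀ D → AgreeOn (λ u → u ∈ A' × u ≢ a) D →
              (∀ h → peg D (a , h) ≡ true) → Reach G t D
    filled' a∈ D agree full with ∈-split {A = A} a∈
    ... | inj₁ refl = win D (λ u u∈A → agree u (∈-old u∈A , λ { refl → v∉A u∈A })) (full h)
    ... | inj₂ a∈A = filled chain a∈A D (λ u q → agree u (∈-old (proj₁ q) , proj₂ q)) full
    boundary' : ∀ {a y i} → a ∈ A' → y ∉ A' → G y a ≡ true → peg D₀ (a , i) ≡ true → Winning A' (y , i)
    boundary' {a} {y} {i} a∈ y∉ e pa D agree py with ∈-split {A = A} a∈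
    ... | inj₂ a∈A = boundary chain a∈A (y∉ ∘ ∈-old) e pa D (λ u u∈A → agree u (∈-old u∈A)) py
    ... | inj₁ refl = leap-reach G D py (trans (agree v ∈-new i) pa) (trans (agree v ∈-new h) e₀)
        (no-loop simple e ∘ cong proj₁) (□-layer G e) (□-fibre G i≢h)
        (win _ (AgreeOn-leap D (λ u u∈A → agree u (∈-old u∈A)) (y∉ ∘ ∈-old) v∉A v∉A)
           (peg-leap D (y , i) (v , i) (v , h)))
      where
      i≢h : i ≢ h
      i≢h refl = contradiction (trans (sym e₀) pa) λ ()

  -- `A` gains a vertex at each step, so `ℓ` bounds the number of steps: at zero, `A` is everything
  -- and no `v` is left outside. The disjunction admits the start, where `A` is empty and `v` lies
  -- under the target.
  explore : ∀ ℓ A v h → m ≤ ∣ A ∣ + ℓ → v ≡ proj₁ t ⊎ proj₁ t ∈ A → v ∉ A → Chain A →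
            Winning A (v , h) → Reach G t D₀
  explore zero A v h m≤ g∈ v∉A chain win = contradiction (subst (v ∈_) (sym A≡⊤) ∈⊤) v∉A
    where
    A≡⊤ : A ≡ ⊤
    A≡⊤ = ∣p∣≡n⇒p≡⊤ (≤-antisym (∣p∣≤n A) (subst (m ≤_) (+-identityʳ ∣ A ∣) m≤))
  explore (suc ℓ) A v h m≤ g∈ v∉A chain win with peg D₀ (v , h) in e₀ | peg D₀ (v , opp h) in e₁
  ... | true | _ = win D₀ (λ _ _ _ → refl) e₀
  ... | false | false = fill-empty v∉A chain win e₀ e₁
  ... | false | true = next (entering A' (g∈' g∈) f∉A')
    where
    A' = A [ v ]≔ true
    chain' : Chain A'
    chain' = grow v∉A chain win e₀ e₁
    g∈' : v ≡ proj₁ t ⊎ proj₁ t ∈ A → proj₁ t ∈ A'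
    g∈' (inj₁ refl) = ∈-new {A = A}
    g∈' (inj₂ g∈A) = ∈-old g∈A
    -- Each fibre over `A'` holds exactly one peg, and the one over `f` does not.
    f∉A' : f ∉ A'
    f∉A' f∈ with single chain' f∈
    ... | i , pi , pi' = f≢1 (half-pair (fibre D₀ f) i
      (trans (lookup-fibre D₀ f i) pi) (trans (lookup-fibre D₀ f (opp i)) pi'))
    card : ∣ A' ∣ ≡ suc ∣ A ∣
    card = card-insert A v (Bool.¬-not (v∉A ∘ lookup⇒[]= v A))
    m≤' : m ≤ ∣ A' ∣ + ℓ
    m≤' = subst (m ≤_) (trans (+-suc ∣ A ∣ ℓ) (cong (_+ ℓ) (sym card))) m≤
    next : ∃[ y ] ∃[ a ] (y ∉ A' × a ∈ A' × G y a ≡ true) → Reach G t D₀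
    next (y , a , y∉ , a∈ , e) with single chain' a∈
    ... | i , pi , _ = explore ℓ A' y i m≤' (inj₂ (g∈' g∈)) y∉ chain' (boundary chain' a∈ y∉ e pi)

  reachable : Reach G t D₀
  reachable = explore m ⊥ (proj₁ t) (proj₂ t) (m≤n+m m ∣ ⊥ {m} ∣) (inj₁ refl) ∉⊥
    (record { single = λ a∈ → contradiction a∈ ∉⊥ ; filled = λ a∈ → contradiction a∈ ∉⊥
            ; boundary = λ a∈ → contradiction a∈ ∉⊥ })
    (λ D _ → already G)

-- The bound for `K 2` and the theorem.

pebbling⇒pegging : ∀ {G : Adj m} {p q} → IsSimple G → 1 ≤ p → PebGood G 1 p → p ≤ q → m < q →
                   PegGood (G □ K 2) q
pebbling⇒pegging {m} {G} {p} simple 1≤p good p≤q m<q D refl x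
  with any? (λ f → ¬? (cnt {m} {2} D f ≟ℕ 1))
... | no none = contradiction (trans (sym (sum-cnt m D)) (all-ones-sum (tabulate (cnt {m} {2} D)) ones)) (≢-sym (<⇒≢ m<q))
  where
  ones : ∀ i → lookup (tabulate (cnt {m} {2} D)) i ≡ 1
  ones i = trans (lookup∘tabulate (cnt {m} {2} D) i)
    (decidable-stable (cnt {m} {2} D i ≟ℕ 1) λ ≢1 → none (i , ≢1))
... | yes (f , f≢1) = subst (PegReachable (G □ K 2) D) (combine-remQuot {m} 2 x)
  (Flipping.reachable G simple (remQuot 2 x) D (good⇒legal {n = 2} good D p≤q) f f≢1 entering)
  where
  -- With all `p` pebbles on `f`, a set avoiding `f` starts empty, so pebbling one of its vertices
  -- needs an edge into it. This is how finiteness of the pebbling number supplies connectedness.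
  c = replicate m 0 [ f ]≔ p
  entering : ∀ A → proj₁ (remQuot 2 x) ∈ A → f ∉ A → ∃[ y ] ∃[ a ] (y ∉ A × a ∈ A × G y a ≡ true)
  entering A g∈A f∉A = entering-edge A g∈A zeros
    (proj₂ (solvable⇒legal (good c (sum-concentrated f p) (proj₁ (remQuot {m} 2 x)))))
    where
    zeros : ∀ u → u ∈ A → lookup c u ≡ 0
    zeros u u∈A = trans (lookup∘update′ {i = u} {f} (λ { refl → f∉A u∈A }) (replicate m 0) p) (lookup-replicate u 0)

theorem4p3 : ∀ (m : ℕ) (G : Adj m) → IsSimple G →
    (∀ (n : ℕ) → 1 ≤ n → ∀ (d p : ℕ) →
    IsPeggingNumber (G □ K n) d → IsTwoPebblingNumber G p → d ≤ p)
    × (∀ (d p : ℕ) →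
    IsPeggingNumber (G □ K 2) d → IsPebblingNumber G p → d ≤ p ⊔ (m + 1))
theorem4p3 m G simple =
  (λ n _ d p (_ , _ , least) (1≤p , good , _) → least p 1≤p (two-pebbling⇒pegging simple good)) ,
  (λ d p (_ , _ , least) (1≤p , good , _) →
     least (p ⊔ (m + 1)) (≤-trans 1≤p (m≤m⊔n p (m + 1)))
       (pebbling⇒pegging simple 1≤p good (m≤m⊔n p (m + 1))
          (≤-trans (≤-reflexive (+-comm 1 m)) (m≤n⊔m p (m + 1)))))
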